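{- Let $N\ge1$ and let $S$ be a 2-string with $|S|=2N$. Then $H_S(x_1,\dots,x_N;\bm{z})=F_S(x_1,\dots,x_N;\bm{z})$.
   Context: **Weights.** All parameters ($q$ and the spectral parameters) are generic/indeterminates; all identities are between rational functions. For $i,j,k,\ell\in\{0,1,2\}$ the Izergin--Korepin vertex weight $W_{y/x}(i,j;k,\ell)$ ($i$ = bottom incoming state, $j$ = left incoming state, $k$ = top outgoing state, $\ell$ = right outgoing state; $x$ = parameter of the horizontal line, $y$ = parameter of the vertical line) depends on $x,y$ only through $y/x$, and, with $D=(x-q^2y)(x-q^3y)$, is given by $W(0,0;0,0)=W(2,2;2,2)=1$; $W(1,0;1,0)=W(2,1;2,1)=\frac{q^2(x-y)}{x-q^2y}$; $W(1,0;0,1)=W(2,1;1,2)=\frac{(1-q^2)x}{x-q^2y}$; $W(0,1;1,0)=W(1,2;2,1)=\frac{(1-q^2)y}{x-q^2y}$; $W(0,1;0,1)=W(1,2;1,2)=\frac{x-y}{x-q^2y}$; $W(2,0;2,0)=\frac{q^4(x-y)(x-qy)}{D}$; $W(2,0;1,1)=-\frac{q(1-q)^2(1+q)x(x-y)}{D}$; $W(2,0;0,2)=\frac{(1-q^2)x(x+qx-qy-q^3y)}{D}$; $W(1,1;2,0)=-\frac{q^4(1+q)(x-y)y}{D}$; $W(1,1;1,1)=\frac{ -qx^2+(1+q)(1-q^2+q^4)xy-q^4y^2}{D}$; $W(1,1;0,2)=\frac{(1+q)x(x-y)}{D}$; $W(0,2;2,0)=\frac{(1-q^2)(x+q^2x-q^2y-q^3y)y}{D}$;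 $W(0,2;1,1)=\frac{q(1-q)^2(1+q)(x-y)y}{D}$; $W(0,2;0,2)=\frac{(x-y)(x-qy)}{D}$; and $W=0$ in all other cases. **2-strings.** A 2-string is an infinite vector $S=(S_1,S_2,\dots)$ with $S_i\in\{0,1,2\}$ and only finitely many nonzero entries; $|S|=\sum_i S_i$. $\bm{z}=(z_1,z_2,\dots)$. **$F_S^I$ and $F_S$.** For $I=(I_1,\dots,I_N)\in\{0,1,2\}^N$ with $|I|=\sum_r I_r=|S|$, choose $L$ with $S_c=0$ for $c>L$ and put $$F_S^I(x_1,\dots,x_N;\bm{z})=\sum\prod_{r=1}^{N}\prod_{c=1}^{L}W_{z_c/x_r}(v_{r-1,c},h_{r,c-1};v_{r,c},h_{r,c}),$$ summed over all $h_{r,c}\in\{0,1,2\}$ ($1\le r\le N$, $0\le c\le L$) and $v_{r,c}\in\{0,1,2\}$ ($0\le r\le N$, $1\le c\le L$) with $h_{r,0}=I_r$, $h_{r,L}=0$, $v_{0,c}=0$, $v_{N,c}=S_c$ (independent of $L$). For $|S|=2N$, $F_S:=F_S^{(2^N)}$. **$H_S$.** For $0\le K\le N$ and $|S|=2K$, $$H_S(x_1,\dots,x_N;\bm{z})=\sum_{I\in\{0,1,2\}^N:\,|I|=2K}(-1)^{\mathfrak{c}_1(I)/2}(1-q^{ -1})^{\mathfrak{c}_1(I)}q^{ -\mathrm{inv}(I)}F_S^I(x_1,\dots,x_N;\bm{z}),$$ where $\mathfrak{c}_1(I)=\#\{r:I_r=1\}$ and $\mathrm{inv}(I)=\sum_{1\le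 i<j\le N}I_i(2-I_j)$. -}

module Defs where

open import Algebra.Apartness.Bundles using (HeytingField)
open import Algebra.Bundles using (CommutativeRing; Semiring)
import Algebra.Definitions.RawSemiring as RawSemiringDefs
open import Data.Bool.Base using (if_then_else_)
open import Data.Fin.Base using (Fin; toℕ; fromℕ; inject₁; suc; zero)
open import Data.Fin.Patterns using (0F; 1F; 2F)
open import Data.Fin.Properties using (_≟_; _<?_; all?)
open import Data.List.Base as List using (List; []; _∷_; allFin; cartesianProductWith; filter)
open import Data.Nat.Base as ℕ using (ℕ; ⌊_/2⌋; _∸_)
import Data.Nat.Properties as ℕ
open import Data.Product.Base using (_×_; proj₁)
open import Data.Vec.Base using (Vec; []; _∷_; count; lookup; replicate)
open import Data.Vec.Functional using (Vector)
open import Level using (_⊔_)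
open import Relation.Binary.PropositionalEquality using (_≡_)
open import Relation.Nullary using (Dec; does)
open import Relation.Nullary.Decidable using (_×-dec_)

open RawSemiringDefs ℕ.+-*-rawSemiring using () renaming (sum to sumℕ)

State : Set
State = Fin 3

-- All positions are counted from 0: entries c is S_{c+1} in one-based notation.
-- The bound is the number L of columns used for the partition function; it is
-- only required to be large enough, not to be minimal.
record TwoString : Set where
  field
    entries  : ℕ → State
    bound    : ℕ
    vanishes : ∀ c → bound ℕ.≤ c → entries c ≡ 0F

open TwoString public

∣_∣ : TwoString → ℕ
∣ S ∣ = sumℕ {bound S} λ c → toℕ (entries S (toℕ c))

size : ∀ {N} → Vec State N → ℕ
size I = sumℕ λ r → toℕ (lookup I r)

𝔠₁ : ∀ {N} → Vec State N → ℕ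
𝔠₁ = count (_≟ 1F)

-- The truncated subtraction is exact, since states are at most 2.
inv : ∀ {N} → Vec State N → ℕ
inv I = sumℕ λ i → sumℕ λ j →
  if does (i <? j) then toℕ (lookup I i) ℕ.* (2 ∸ toℕ (lookup I j)) else 0

vectors : ∀ {a} {A : Set a} → List A → (n : ℕ) → List (Vec A n)
vectors as ℕ.zero    = [] ∷ []
vectors as (ℕ.suc n) = cartesianProductWith _∷_ as (vectors as n)

states : (n : ℕ) → List (Vec State n)
states = vectors (allFin 3)

-- lookup (lookup h r) c is h_{r+1,c} and lookup (lookup v r) c is v_{r,c+1}.
HorizontalEdges VerticalEdges : ℕ → ℕ → Set
HorizontalEdges N L = Vec (Vec State (ℕ.suc L)) N
VerticalEdges   N L = Vec (Vec State L) (ℕ.suc N)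

Boundary : ∀ {N L} → Vec State N → (ℕ → State) →
           HorizontalEdges N L → VerticalEdges N L → Set
Boundary {N} {L} I S h v =
  (∀ r → lookup (lookup h r) zero ≡ lookup I r) ×
  (∀ r → lookup (lookup h r) (fromℕ L) ≡ 0F) ×
  (∀ c → lookup (lookup v zero) c ≡ 0F) ×
  (∀ c → lookup (lookup v (fromℕ N)) c ≡ S (toℕ c))

boundary? : ∀ {N L} (I : Vec State N) (S : ℕ → State)
            (h : HorizontalEdges N L) (v : VerticalEdges N L) → Dec (Boundary I S h v)
boundary? I S h v =
  all? (λ r → _ ≟ _) ×-dec all? (λ r → _ ≟ _) ×-dec
  all? (λ c → _ ≟ _) ×-dec all? (λ c → _ ≟ _)

-- An identity of rational functions is stated over an arbitrary field, for all
-- values of the parameters at which the denominators occurring in it do not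
-- vanish; the field of rational functions with q, x and z the indeterminates
-- is one instance.
module IzerginKorepin {c ℓ₁ ℓ₂} (K : HeytingField c ℓ₁ ℓ₂) where

  open HeytingField K

  private
    commutativeRing : CommutativeRing c ℓ₁
    commutativeRing = record { isCommutativeRing = isCommutativeRing }

  open RawSemiringDefs (Semiring.rawSemiring (CommutativeRing.semiring commutativeRing))
    using (_^_; product)

  -- The inverse of the difference a - b.
  _⁻¹ : ∀ {a b} → a # b → Carrier
  a#b ⁻¹ = proj₁ (#⇒invertible a#b)

  ∑ : ∀ {a} {A : Set a} → List A → (A → Carrier) → Carrier
  ∑ as f = List.foldr (λ a s → f a + s) 0# as

  record Generic {N : ℕ} (q : Carrier) (x : Vector Carrier N) (z : ℕ → Carrier) : Set ℓ₂ where
    field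
      q#0   : q # 0#
      x#q²z : ∀ r c → x r # q ^ 2 * z c
      x#q³z : ∀ r c → x r # q ^ 3 * z c

  open Generic

  -- The arguments i j k l are the bottom, left, top and right states.
  W : (q x y : Carrier) → x # q ^ 2 * y → x # q ^ 3 * y →
      (i j k l : State) → Carrier
  W q x y x#q²y x#q³y = weight
    where
    d⁻¹ D⁻¹ : Carrier
    d⁻¹ = x#q²y ⁻¹
    D⁻¹ = x#q²y ⁻¹ * x#q³y ⁻¹

    weight : (i j k l : State) → Carrier
    weight 0F 0F 0F 0F = 1#
    weight 2F 2F 2F 2F = 1#
    weight 1F 0F 1F 0F = q ^ 2 * (x - y) * d⁻¹
    weight 2F 1F 2F 1F = q ^ 2 * (x - y) * d⁻¹
    weight 1F 0F 0F 1F = (1# - q ^ 2) * x * d⁻¹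
    weight 2F 1F 1F 2F = (1# - q ^ 2) * x * d⁻¹
    weight 0F 1F 1F 0F = (1# - q ^ 2) * y * d⁻¹
    weight 1F 2F 2F 1F = (1# - q ^ 2) * y * d⁻¹
    weight 0F 1F 0F 1F = (x - y) * d⁻¹
    weight 1F 2F 1F 2F = (x - y) * d⁻¹
    weight 2F 0F 2F 0F = q ^ 4 * (x - y) * (x - q * y) * D⁻¹
    weight 2F 0F 1F 1F = - (q * (1# - q) ^ 2 * (1# + q) * x * (x - y) * D⁻¹)
    weight 2F 0F 0F 2F = (1# - q ^ 2) * x * (x + q * x - q * y - q ^ 3 * y) * D⁻¹
    weight 1F 1F 2F 0F = - (q ^ 4 * (1# + q) * (x - y) * y * D⁻¹)
    weight 1F 1F 1F 1F =
      (- (q * x ^ 2) + (1# + q) * (1# - q ^ 2 + q ^ 4) * x * y - q ^ 4 * y ^ 2) * D⁻¹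
    weight 1F 1F 0F 2F = (1# + q) * x * (x - y) * D⁻¹
    weight 0F 2F 2F 0F = (1# - q ^ 2) * (x + q ^ 2 * x - q ^ 2 * y - q ^ 3 * y) * y * D⁻¹
    weight 0F 2F 1F 1F = q * (1# - q) ^ 2 * (1# + q) * (x - y) * y * D⁻¹
    weight 0F 2F 0F 2F = (x - y) * (x - q * y) * D⁻¹
    weight _  _  _  _  = 0#

  module _ {N : ℕ} {q : Carrier} {x : Vector Carrier N} {z : ℕ → Carrier}
           (generic : Generic q x z) where

    F^ : Vec State N → TwoString → Carrier
    F^ I S =
      ∑ (vectors (states (ℕ.suc L)) N) λ h →
      ∑ (filter (boundary? I (entries S) h) (vectors (states L) (ℕ.suc N))) λ v →
      product {N} λ r → product {L} λ c →
        W q (x r) (z (toℕ c)) (x#q²z generic r (toℕ c)) (x#q³z generic r (toℕ c))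
          (lookup (lookup v (inject₁ r)) c) (lookup (lookup h r) (inject₁ c))
          (lookup (lookup v (suc r)) c)     (lookup (lookup h r) (suc c))
      where
      L : ℕ
      L = bound S

    F : TwoString → Carrier
    F = F^ (replicate N 2F)

    -- For ∣ S ∣ even, so that 𝔠₁ I is even for every I of the same size and
    -- its half is exact.
    H : TwoString → Carrier
    H S = ∑ (filter (λ I → size I ℕ.≟ ∣ S ∣) (states N)) λ I →
      (- 1#) ^ ⌊ 𝔠₁ I /2⌋ * (1# - q⁻¹) ^ 𝔠₁ I * q⁻¹ ^ inv I * F^ I S
      where
      q⁻¹ : Carrier
      q⁻¹ = q#0 generic ⁻¹

{-# OPTIONS --safe #-}
module Submission where

-- Every entry of I is at most 2, so |I| = 2N for a vector I of length N forces
-- I = (2^N): at the maximal size the sum defining H has a single term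
-- (filter-size). Its prefactor is 1, because (2^N) has no entry equal to 1
-- (𝔠₁-replicate) and each term I_i (2 - I_j) of inv vanishes (inv-replicate).
-- The remaining factor is F by definition. The vertex weights play no role.

open import Defs
open import Algebra.Apartness.Bundles using (HeytingField)
open import Data.Nat.Base using (ℕ; _≤_) renaming (_*_ to _*ℕ_)
open import Data.Vec.Functional using (Vector)
open import Relation.Binary.PropositionalEquality using (_≡_)

open import Algebra.Bundles using (CommutativeRing; Semiring)
import Algebra.Definitions.RawSemiring as RawSemiringDefs
import Algebra.Properties.Monoid.Sum as Sum
open import Data.Bool.Base using (false; true; if_then_else_)
open import Data.Fin.Base using (Fin; toℕ)
open import Data.Fin.Patterns using (0F; 1F; 2F)
open import Data.Fin.Properties using (_<?_; toℕ≤pred[n])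
open import Data.List.Base using (List; []; _∷_; _++_; filter; map)
open import Data.List.Properties using (filter-++; filter-none; filter-≐; ++-identityʳ)
open import Data.List.Relation.Unary.All using (universal)
import Data.List.Relation.Unary.All.Properties as All
open import Data.Nat.Base as ℕ using (⌊_/2⌋; _∸_)
import Data.Nat.Properties as ℕ
open import Data.Product.Base using (_,_)
open import Data.Vec.Base using (Vec; []; _∷_; lookup; replicate)
open import Data.Vec.Properties using (lookup-replicate)
open import Function.Base using (_∘_)
open import Relation.Binary.PropositionalEquality using (_≢_; refl; cong; cong₂; trans; module ≡-Reasoning)
open import Relation.Nullary using (does)
open import Relation.Unary using (Pred; Decidable)

open Sum ℕ.+-0-monoid using (sum; sum-cong-≗; sum-replicate-zero)

filter-map : ∀ {a b p} {A : Set a} {B : Set b} {P : Pred B p} (P? : Decidable P)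
             (f : A → B) (as : List A) →
             filter P? (map f as) ≡ map f (filter (P? ∘ f) as)
filter-map P? f []       = refl
filter-map P? f (a ∷ as) with does (P? (f a))
... | true  = cong (f a ∷_) (filter-map P? f as)
... | false = filter-map P? f as

size≤ : ∀ {N} (I : Vec State N) → size I ≤ N *ℕ 2
size≤ []      = ℕ.z≤n
size≤ (i ∷ I) = ℕ.+-mono-≤ (toℕ≤pred[n] i) (size≤ I)

size-∷-< : ∀ {N} {i : State} (I : Vec State N) → toℕ i ℕ.< 2 → size (i ∷ I) ≢ ℕ.suc N *ℕ 2
size-∷-< I i<2 = ℕ.<⇒≢ (ℕ.+-mono-<-≤ i<2 (size≤ I))

-- The only vector of length N and size 2N is (2^N), and it is listed once.
filter-size : ∀ N {s} → s ≡ N *ℕ 2 →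
              filter (λ I → size I ℕ.≟ s) (states N) ≡ replicate N 2F ∷ []
filter-size ℕ.zero    refl = refl
filter-size (ℕ.suc N) refl = begin
  filter P? (map (0F ∷_) Is ++ map (1F ∷_) Is ++ map (2F ∷_) Is ++ [])
    ≡⟨ filter-++ P? (map (0F ∷_) Is) _ ⟩
  filter P? (map (0F ∷_) Is) ++ filter P? (map (1F ∷_) Is ++ map (2F ∷_) Is ++ [])
    ≡⟨ cong₂ _++_ (none ℕ.z<s) (filter-++ P? (map (1F ∷_) Is) _) ⟩
  filter P? (map (1F ∷_) Is) ++ filter P? (map (2F ∷_) Is ++ [])
    ≡⟨ cong₂ _++_ (none ℕ.≤-refl) (cong (filter P?) (++-identityʳ (map (2F ∷_) Is))) ⟩
  filter P? (map (2F ∷_) Is)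
    ≡⟨ filter-map P? (2F ∷_) Is ⟩
  map (2F ∷_) (filter (P? ∘ (2F ∷_)) Is)
    ≡⟨ cong (map (2F ∷_)) (filter-≐ _ _ (ℕ.+-cancelˡ-≡ 2 _ _ , cong (2 ℕ.+_)) Is) ⟩
  map (2F ∷_) (filter (λ I → size I ℕ.≟ N *ℕ 2) Is)
    ≡⟨ cong (map (2F ∷_)) (filter-size N refl) ⟩
  replicate (ℕ.suc N) 2F ∷ []
    ∎
  where
  open ≡-Reasoning

  Is : List (Vec State N)
  Is = states N

  P? : Decidable (λ (I : Vec State (ℕ.suc N)) → size I ≡ ℕ.suc N *ℕ 2)
  P? I = size I ℕ.≟ ℕ.suc N *ℕ 2

  none : ∀ {i} → toℕ i ℕ.< 2 → filter P? (map (i ∷_) Is) ≡ []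
  none i<2 = filter-none P? (All.map⁺ (universal (λ I → size-∷-< I i<2) Is))

𝔠₁-replicate : ∀ N → 𝔠₁ (replicate N 2F) ≡ 0
𝔠₁-replicate ℕ.zero    = refl
𝔠₁-replicate (ℕ.suc N) = 𝔠₁-replicate N

sum-zero : ∀ {n} {f : Vector ℕ n} → (∀ i → f i ≡ 0) → sum f ≡ 0
sum-zero {n} f≗0 = trans (sum-cong-≗ f≗0) (sum-replicate-zero n)

inv-replicate : ∀ N → inv (replicate N 2F) ≡ 0
inv-replicate N = sum-zero λ i → sum-zero λ j → term i j
  where
  term : (i j : Fin N) →
         (if does (i <? j)
          then toℕ (lookup (replicate N 2F) i) *ℕ (2 ∸ toℕ (lookup (replicate N 2F) j))
          else 0) ≡ 0
  term i j with does (i <? j)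
  ... | false = refl
  ... | true  = begin
    toℕ (lookup (replicate N 2F) i) *ℕ (2 ∸ toℕ (lookup (replicate N 2F) j))
      ≡⟨ cong (λ s → toℕ (lookup (replicate N 2F) i) *ℕ (2 ∸ toℕ s)) (lookup-replicate j 2F) ⟩
    toℕ (lookup (replicate N 2F) i) *ℕ 0
      ≡⟨ ℕ.*-zeroʳ (toℕ (lookup (replicate N 2F) i)) ⟩
    0 ∎
    where open ≡-Reasoning

module _ {c ℓ₁ ℓ₂} (K : HeytingField c ℓ₁ ℓ₂) where

  open HeytingField K hiding (refl; trans)
  open IzerginKorepin K
  open import Relation.Binary.Reasoning.Setoid setoid

  private
    commutativeRing : CommutativeRing c ℓ₁
    commutativeRing = record { isCommutativeRing = isCommutativeRing }

  open RawSemiringDefs (Semiring.rawSemiring (CommutativeRing.semiring commutativeRing)) using (_^_)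

  ∑-singleton : ∀ {a} {A : Set a} {as : List A} {b} {f : A → Carrier} →
                as ≡ b ∷ [] → ∑ as f ≈ f b
  ∑-singleton refl = +-identityʳ _

  trivial-prefactor : ∀ a b d f {m n} → m ≡ 0 → n ≡ 0 →
                      a ^ ⌊ m /2⌋ * b ^ m * d ^ n * f ≈ f
  trivial-prefactor a b d f refl refl = begin
    1# * 1# * 1# * f  ≈⟨ *-congʳ (*-identityʳ _) ⟩
    1# * 1# * f       ≈⟨ *-congʳ (*-identityʳ _) ⟩
    1# * f            ≈⟨ *-identityˡ f ⟩
    f                 ∎

proposition1p7p1 : ∀ {c ℓ₁ ℓ₂} (K : HeytingField c ℓ₁ ℓ₂) →
    let open HeytingField K
        open IzerginKorepin K
    in
    (N : ℕ) → 1 ≤ N →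
    (q : Carrier) (x : Vector Carrier N) (z : ℕ → Carrier) →
    (generic : Generic q x z) →
    (S : TwoString) → ∣ S ∣ ≡ 2 *ℕ N →
    H generic S ≈ F generic S
proposition1p7p1 K N _ q x z generic S ∣S∣≡2N =
  K.trans (∑-singleton K (filter-size N (trans ∣S∣≡2N (ℕ.*-comm 2 N))))
          (trivial-prefactor K _ _ _ (F generic S) (𝔠₁-replicate N) (inv-replicate N))
  where
  module K = HeytingField K
  open IzerginKorepin K using (F)
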